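{- Every standard multigraph $M$ on $n$ vertices with $\delta(M)\ge\frac{3n-3}{2}$ contains $\lfloor\frac{n}{3}\rfloor$ pairwise vertex-disjoint $5$-triangles.
   Context: Multigraphs have no loops; $\mu(x,y)$ is the number of edges with ends $x,y$; $M$ is standard if $\mu(x,y)\le2$ for all $x,y$; $d(x)=\sum_y\mu(x,y)$ and $\delta(M)=\min_x d(x)$. A $5$-triangle is a multigraph on three vertices containing a triangle $C_3$ and having exactly $5$ edges counted with multiplicity; $M$ contains a $5$-triangle on $\{x,y,z\}$ iff $x,y,z$ are pairwise adjacent and $\mu(x,y)+\mu(y,z)+\mu(x,z)\ge5$. -}

module Defs where

open import Data.Nat using (ℕ; _+_; _*_; _∸_; _≤_; _≥_; _/_)
open import Data.Fin using (Fin; zero; suc)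
open import Data.Fin.Patterns using (0F; 1F; 2F)
open import Data.Product using (_×_; Σ; _,_)
open import Data.Vec.Functional using (Vector)
open import Data.Vec.Functional.Properties using ()
open import Function.Definitions using (Injective)
open import Relation.Binary.PropositionalEquality using (_≡_)
import Data.Fin.Properties

∑ : ∀ {n} → (Fin n → ℕ) → ℕ
∑ {ℕ.zero} f = 0
∑ {ℕ.suc n} f = f zero + ∑ (λ i → f (suc i))

-- A loopless multigraph on vertex set Fin n, given by its multiplicity
-- function μ (μ x y = number of edges with ends x, y).
record Multigraph (n : ℕ) : Set where
  field
    μ         : Fin n → Fin n → ℕ
    symmetric : ∀ x y → μ x y ≡ μ y x
    loopless  : ∀ x → μ x x ≡ 0

open Multigraph public

Standard : ∀ {n} → Multigraph n → Set
Standard M = ∀ x y → μ M x y ≤ 2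

deg : ∀ {n} → Multigraph n → Fin n → ℕ
deg M x = ∑ (λ y → μ M x y)

-- δ(M) ≥ (3n-3)/2, written with multiplication by 2 (exact over ℕ for n ≥ 1;
-- for n = 0 there are no vertices and the condition is vacuous)
MinDegreeAtLeast3n-3/2 : ∀ {n} → Multigraph n → Set
MinDegreeAtLeast3n-3/2 {n} M = ∀ x → 2 * deg M x ≥ 3 * n ∸ 3

Adjacent : ∀ {n} → Multigraph n → Fin n → Fin n → Set
Adjacent M x y = 1 ≤ μ M x y

FiveTriangle : ∀ {n} → Multigraph n → Fin n → Fin n → Fin n → Set
FiveTriangle M x y z =
  Adjacent M x y × Adjacent M y z × Adjacent M x z ×
  (μ M x y + μ M y z + μ M x z ≥ 5)

-- k pairwise vertex-disjoint 5-triangles: an injective assignment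
-- t : Fin k × Fin 3 → Fin n (triangle i has vertices t(i,0), t(i,1), t(i,2)),
-- each triple forming a 5-triangle. Injectivity gives both that the three
-- vertices of a triangle are distinct and that different triangles are disjoint.
DisjointFiveTriangles : ∀ {n} → Multigraph n → ℕ → Set
DisjointFiveTriangles {n} M k =
  Σ (Fin k × Fin 3 → Fin n) λ t →
    Injective _≡_ _≡_ t ×
    (∀ i → FiveTriangle M (t (i , 0F)) (t (i , 1F)) (t (i , 2F)))

{-# OPTIONS --safe #-}

-- Add edges one at a time, starting from M, until the multigraph is complete,
-- where the claim is obvious, and go back: in a tiling of M + xy at most one
-- triangle W (the one through x) fails to be a 5-triangle of M, and then W has
-- exactly four edges, with multiplicities (2,2,0) or (2,1,1). Give the vertices
-- of W weights of sum 8, and let g y be the weighted number of edges from y to W.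
-- If g y > 12 for some uncovered y, then y replaces a vertex of W; if g has sum
-- > 36 on another triangle A, then exchanging a vertex of W with one of A makes
-- both triangles 5-triangles (a finite check). Otherwise, since g has sum ≤ 20
-- on W, the k triangles give ∑ g ≤ 20 + 36 (k - 1) + 12 (n - 3k) = 12 n - 16,
-- whereas the degree condition gives ∑ g ≥ 8 (3n - 3) / 2 = 12 n - 12.

module Submission where

open import Defs
open import Data.Bool using (if_then_else_)
open import Data.Fin using (Fin; zero; suc; toℕ; fromℕ<; combine; cast)
open import Data.Fin.Patterns using (0F; 1F; 2F)
import Data.Fin.Properties as Fin
open import Data.List using (List; []; _∷_; length; map; take; allFin; lookup)
import Data.List.Membership.DecPropositional as DecMembership
open import Data.List.Membership.Propositional using (_∈_; _∉_)
open import Data.List.Membership.Propositional.Properties using (∈-lookup)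
open import Data.List.Properties using (map-cong-local; length-take; length-tabulate)
open import Data.List.Relation.Binary.Permutation.Propositional
  using (_↭_; refl; prep; swap; trans; ↭-sym; ↭⇒↭ₛ)
import Data.List.Relation.Binary.Permutation.Setoid.Properties as ↭ₛ
open import Data.List.Relation.Unary.All as All using ([]; _∷_)
open import Data.List.Relation.Unary.All.Properties using (¬Any⇒All¬; All¬⇒¬Any)
open import Data.List.Relation.Unary.AllPairs using ([]; _∷_)
open import Data.List.Relation.Unary.Any using (here; there)
open import Data.List.Relation.Unary.Unique.Propositional using (Unique)
import Data.List.Relation.Unary.Unique.Propositional.Properties as Unique
open import Data.Nat
  using (ℕ; zero; suc; _+_; _*_; _∸_; _/_; _≤_; _<_; _≥_; z≤n; s≤s; s≤s⁻¹; _≤?_; _<?_; _≟_)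
open import Data.Nat.DivMod using (m/n*n≤m)
open import Data.Nat.ListAction using (sum)
open import Data.Nat.Properties
open import Data.Nat.Solver using (module +-*-Solver)
open import Data.Product using (∃; _×_; _,_; proj₂)
open import Data.Sum using (_⊎_; inj₁; inj₂)
open import Data.Unit using (tt)
open import Data.Vec as Vec using (Vec; []; _∷_)
open import Data.Vec.Functional as F using (updateAt)
open import Data.Vec.Functional.Properties using (updateAt-updates; updateAt-minimal)
open import Data.Vec.Properties using (lookup∘tabulate)
open import Function using (_∘_; const)
open import Relation.Binary.PropositionalEquality as ≡
  using (_≡_; _≢_; refl; sym; cong; cong₂; subst; setoid; module ≡-Reasoning)
open import Relation.Nullary using (Dec; does; yes; no; contradiction)
open import Relation.Nullary.Decidable
  using (_×-dec_; _→-dec_; ¬?; map′; toWitness; from-yes; dec-true; dec-false)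
open import Relation.Unary using (Decidable)

-- Triangles with four edges: weights and finite checks.

next : Fin 3 → Fin 3
next 0F = 1F
next 1F = 2F
next 2F = 0F

Triple : Set
Triple = Fin 3 → ℕ

Five : ℕ → ℕ → ℕ → Set
Five p q r = 1 ≤ p × 1 ≤ q × 1 ≤ r × p + q + r ≥ 5

five? : ∀ p q r → Dec (Five p q r)
five? p q r = (1 ≤? p) ×-dec (1 ≤? q) ×-dec (1 ≤? r) ×-dec (5 ≤? p + q + r)

total : Triple → ℕ
total t = t 0F + t 1F + t 2F

weight : Triple → Triple → ℕ
weight ω r = total (λ i → ω i * r i)

-- A triangle has edge multiplicities W, where W i is the multiplicity of the
-- edge opposite to vertex i. Multiplicities (2,2,0) get weight 2 at the common
-- end of the double edges and 3 elsewhere; multiplicities (2,1,1) get weight 4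
-- opposite to the double edge and 2 elsewhere.
weights : Triple → Triple
weights W i =
  if does (W 0F * W 1F * W 2F ≟ 0)
  then (if does (W i ≟ 0) then 2 else 3)
  else 2 * W i

-- Row `i` of the adjacency matrix of the triangle whose opposite-edge multiplicities are `W`.
inside : Triple → Fin 3 → Triple
inside W 0F = 0 F.∷ W 2F F.∷ W 1F F.∷ F.[]
inside W 1F = W 2F F.∷ 0 F.∷ W 0F F.∷ F.[]
inside W 2F = W 1F F.∷ W 0F F.∷ 0 F.∷ F.[]

-- `r` holds the multiplicities from a new vertex to those of the triangle. The new vertex takes the
-- place of vertex `i`, so only the edge opposite to `i` survives.
Completes : Triple → Triple → Fin 3 → Set
Completes W r i = Five (r (next i)) (W i) (r (next (next i)))

completes? : ∀ W r i → Dec (Completes W r i)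
completes? W r i = five? (r (next i)) (W i) (r (next (next i)))

-- Row c j holds the multiplicities from vertex j of the triangle A to the
-- vertices of W; the two triangles arise by exchanging vertex i of W with
-- vertex j of A.
Exchange : Triple → Triple → (Fin 3 → Triple) → Set
Exchange W A c = ∃ λ i → ∃ λ j →
  Completes W (c j) i × Five (A j) (c (next (next j)) i) (c (next j) i)

exchange? : ∀ W A c → Dec (Exchange W A c)
exchange? W A c = Fin.any? λ i → Fin.any? λ j →
  completes? W (c j) i ×-dec five? (A j) (c (next (next j)) i) (c (next j) i)

allVec? : ∀ {m} n {P : Vec (Fin m) n → Set} → Decidable P → Dec (∀ v → P v)
allVec? zero    P? = map′ (λ { p [] → p }) (λ f → f []) (P? [])
allVec? (suc n) P? = map′ (λ { h (x ∷ v) → h x v }) (λ f x v → f (x ∷ v))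
  (Fin.all? λ x → allVec? n λ v → P? (x ∷ v))

-- Multiplicities at most 2 are coded by vectors over `Fin 3`: unlike functions, vectors can be
-- exhausted by pattern matching without extensionality, so that properties of all of them can be
-- decided.
val : Vec (Fin 3) 3 → Triple
val v i = toℕ (Vec.lookup v i)

rows : (u v w : Vec (Fin 3) 3) → Fin 3 → Triple
rows u v w = val u F.∷ val v F.∷ val w F.∷ F.[]

-- The condition on two rows follows from weight≤16; it prunes the enumeration.
Exchangeable : Vec (Fin 3) 3 → Set
Exchangeable w = let ω = weights (val w) in total (val w) ≡ 4 →
  ∀ a → Five (val a 2F) (val a 0F) (val a 1F) →
  ∀ u v → 21 ≤ weight ω (val u) + weight ω (val v) →
  ∀ t → 37 ≤ weight ω (val u) + weight ω (val v) + weight ω (val t) →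
  Exchange (val w) (val a) (rows u v t)

exchangeable? : ∀ w → Dec (Exchangeable w)
exchangeable? w =
  (total (val w) ≟ 4) →-dec allVec? 3 λ a →
  five? (val a 2F) (val a 0F) (val a 1F) →-dec allVec? 3 λ u → allVec? 3 λ v →
  (21 ≤? _) →-dec allVec? 3 λ t →
  (37 ≤? _) →-dec exchange? (val w) (val a) (rows u v t)

abstract

  weights-total : ∀ w → total (val w) ≡ 4 → total (weights (val w)) ≡ 8
  weights-total = toWitness {a? = allVec? 3 λ w → (total (val w) ≟ 4) →-dec (_ ≟ _)} tt

  -- Summed by columns, this is weight times degree inside the triangle: 2·4 + 3·2 + 3·2 or 4·2 +
  -- 2·3 + 2·3, both equal to 20.
  weights-inside : ∀ w → total (val w) ≡ 4 →
    total (λ i → weight (weights (val w)) (inside (val w) i)) ≤ 20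
  weights-inside = toWitness {a? = allVec? 3 λ w → (total (val w) ≟ 4) →-dec (_ ≤? _)} tt

  weight≤16 : ∀ w → total (val w) ≡ 4 → ∀ u → weight (weights (val w)) (val u) ≤ 16
  weight≤16 = toWitness {a? = allVec? 3 λ w →
    (total (val w) ≟ 4) →-dec allVec? 3 λ u → _ ≤? 16} tt

  -- Weight 13 out of 16 allows a loss of at most 3, and each missing edge costs at least 2, so at
  -- most one is missing. With the ends of a double edge of the triangle, the new vertex then spans
  -- at least 3 + 2 edges.
  completable : ∀ w → total (val w) ≡ 4 → ∀ u →
    13 ≤ weight (weights (val w)) (val u) → ∃ (Completes (val w) (val u))
  completable = toWitness {a? = allVec? 3 λ w → (total (val w) ≟ 4) →-dec
    allVec? 3 λ u → (13 ≤? _) →-dec Fin.any? (completes? (val w) (val u))} tt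

  all-exchangeable : ∀ w → Exchangeable w
  all-exchangeable = from-yes (allVec? 3 exchangeable?)

  exchangeable : ∀ w → total (val w) ≡ 4 →
    ∀ a → Five (val a 2F) (val a 0F) (val a 1F) →
    ∀ u v t → 37 ≤ total (λ j → weight (weights (val w)) (rows u v t j)) →
    Exchange (val w) (val a) (rows u v t)
  exchangeable w e a A u v t h = all-exchangeable w e a A u v
    (+-cancelʳ-≤ 16 21 _ (≤-trans h (+-monoʳ-≤ _ (weight≤16 w e t)))) t h

-- Sums over triples and over all vertices.

private variable
  n k : ℕ

total-cong : ∀ {f g : Triple} → (∀ i → f i ≡ g i) → total f ≡ total g
total-cong e = cong₂ _+_ (cong₂ _+_ (e 0F) (e 1F)) (e 2F)

weight-cong : ∀ ω {r r′} → (∀ i → r i ≡ r′ i) → weight ω r ≡ weight ω r′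
weight-cong ω e = total-cong λ i → cong (ω i *_) (e i)

five-cong : ∀ {p q r p′ q′ r′} → p ≡ p′ → q ≡ q′ → r ≡ r′ → Five p q r → Five p′ q′ r′
five-cong refl refl refl h = h

-- Two multiplicities reach at most 4, so a sum of 5 forces the third to be positive: adjacency is
-- recovered from the edge count alone.
five-of-sum : ∀ {p q r} → p ≤ 2 → q ≤ 2 → r ≤ 2 → 5 ≤ p + q + r → Five p q r
five-of-sum {zero} p q r h = contradiction h (<⇒≱ (s≤s (+-mono-≤ q r)))
five-of-sum {suc p′} {zero} {r′} p q r h =
  contradiction h (<⇒≱ (s≤s
    (subst (λ s → s + r′ ≤ 4) (sym (+-identityʳ (suc p′))) (+-mono-≤ p r))))
five-of-sum {suc p′} {suc q′} {zero} p q r h =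
  contradiction h (<⇒≱ (s≤s (subst (_≤ 4) (sym (+-identityʳ _)) (+-mono-≤ p q))))
five-of-sum {suc _} {suc _} {suc _} p q r h = s≤s z≤n , s≤s z≤n , s≤s z≤n , h

encode : (t : Triple) → (∀ i → t i ≤ 2) → ∃ λ v → ∀ i → val v i ≡ t i
encode t b = Vec.tabulate f , λ i →
  ≡.trans (cong toℕ (lookup∘tabulate f i)) (Fin.toℕ-fromℕ< (s≤s (b i)))
  where
  f : Fin 3 → Fin 3
  f i = fromℕ< (s≤s (b i))

∑-cong : {f g : Fin n → ℕ} → (∀ i → f i ≡ g i) → ∑ f ≡ ∑ g
∑-cong {zero}  e = refl
∑-cong {suc n} e = cong₂ _+_ (e zero) (∑-cong (e ∘ suc))

∑-mono-≤ : {f g : Fin n → ℕ} → (∀ i → f i ≤ g i) → ∑ f ≤ ∑ g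
∑-mono-≤ {zero}  h = z≤n
∑-mono-≤ {suc n} h = +-mono-≤ (h zero) (∑-mono-≤ (h ∘ suc))

∑-mono-< : {f g : Fin n → ℕ} → (∀ i → f i ≤ g i) → ∀ i → f i < g i → ∑ f < ∑ g
∑-mono-< h zero    l = +-mono-<-≤ l (∑-mono-≤ (h ∘ suc))
∑-mono-< h (suc i) l = +-mono-≤-< (h zero) (∑-mono-< (h ∘ suc) i l)

∑-+ : (f g : Fin n → ℕ) → ∑ (λ i → f i + g i) ≡ ∑ f + ∑ g
∑-+ {zero}  f g = refl
∑-+ {suc n} f g = begin
  f zero + g zero + ∑ (λ i → f (suc i) + g (suc i))
    ≡⟨ cong (f zero + g zero +_) (∑-+ (f ∘ suc) (g ∘ suc)) ⟩
  f zero + g zero + (∑ (f ∘ suc) + ∑ (g ∘ suc))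
    ≡⟨ solve 4 (λ a b c d → a :+ b :+ (c :+ d) := a :+ c :+ (b :+ d)) refl (f zero) _ _ _ ⟩
  f zero + ∑ (f ∘ suc) + (g zero + ∑ (g ∘ suc))
    ∎
  where
  open ≡-Reasoning
  open +-*-Solver

∑-* : ∀ c (f : Fin n → ℕ) → ∑ (λ i → c * f i) ≡ c * ∑ f
∑-* {zero}  c f = sym (*-zeroʳ c)
∑-* {suc n} c f =
  ≡.trans (cong (c * f zero +_) (∑-* c (f ∘ suc))) (sym (*-distribˡ-+ c (f zero) _))

∑-const : ∀ c → ∑ {n} (const c) ≡ c * n
∑-const {zero}  c = sym (*-zeroʳ c)
∑-const {suc n} c = ≡.trans (cong (c +_) (∑-const c)) (sym (*-suc c n))

∑-weight : ∀ ω (f : Fin n → Triple) →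
  ∑ (λ y → weight ω (f y)) ≡ weight ω (λ i → ∑ (λ y → f y i))
∑-weight ω f = begin
  ∑ (λ y → p 0F y + p 1F y + p 2F y)    ≡⟨ ∑-+ (λ y → p 0F y + p 1F y) (p 2F) ⟩
  ∑ (λ y → p 0F y + p 1F y) + ∑ (p 2F)  ≡⟨ cong (_+ ∑ (p 2F)) (∑-+ (p 0F) (p 1F)) ⟩
  total (∑ ∘ p)                         ≡⟨ total-cong (λ i → ∑-* (ω i) (λ y → f y i)) ⟩
  weight ω (λ i → ∑ (λ y → f y i))      ∎
  where
  open ≡-Reasoning
  p : Fin 3 → Fin _ → ℕ
  p i y = ω i * f y i

∑-updateAt : ∀ (f : Fin n → ℕ) x c → ∑ (updateAt f x (const c)) + f x ≡ ∑ f + c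
∑-updateAt f zero c = solve 3 (λ c s x → c :+ s :+ x := x :+ s :+ c) refl c _ (f zero)
  where open +-*-Solver
∑-updateAt f (suc x) c = begin
  f zero + ∑ (updateAt (f ∘ suc) x (const c)) + f (suc x)    ≡⟨ +-assoc (f zero) _ _ ⟩
  f zero + (∑ (updateAt (f ∘ suc) x (const c)) + f (suc x))  ≡⟨ cong (f zero +_) ih ⟩
  f zero + (∑ (f ∘ suc) + c)                                 ≡⟨ +-assoc (f zero) _ _ ⟨
  f zero + ∑ (f ∘ suc) + c                                   ∎
  where
  open ≡-Reasoning
  ih = ∑-updateAt (f ∘ suc) x c

-- Adding `c * length xs` on the left avoids subtraction. In the induction the value at the head is
-- overwritten by `c`, so that the head obeys the bound required outside the tail.
∑-bound : ∀ (g : Fin n → ℕ) c {xs} → Unique xs → (∀ y → y ∉ xs → g y ≤ c) →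
  ∑ g + c * length xs ≤ sum (map g xs) + c * n
∑-bound {n} g c {[]} _ h = begin
  ∑ g + c * 0      ≡⟨ cong (∑ g +_) (*-zeroʳ c) ⟩
  ∑ g + 0          ≡⟨ +-identityʳ _ ⟩
  ∑ g              ≤⟨ ∑-mono-≤ (λ y → h y λ ()) ⟩
  ∑ {n} (const c)  ≡⟨ ∑-const c ⟩
  c * n            ∎
  where open ≤-Reasoning
∑-bound {n} g c {x ∷ xs} (x∉ ∷ u) h = begin
  ∑ g + c * suc (length xs)        ≡⟨ cong (∑ g +_) (*-suc c _) ⟩
  ∑ g + (c + c * length xs)        ≡⟨ +-assoc (∑ g) c _ ⟨
  ∑ g + c + c * length xs          ≡⟨ cong (_+ c * length xs) (∑-updateAt g x c) ⟨
  ∑ g′ + g x + c * length xs       ≡⟨ cong (_+ c * length xs) (+-comm (∑ g′) (g x)) ⟩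
  g x + ∑ g′ + c * length xs       ≡⟨ +-assoc (g x) _ _ ⟩
  g x + (∑ g′ + c * length xs)     ≤⟨ +-monoʳ-≤ (g x) (∑-bound g′ c u outside) ⟩
  g x + (sum (map g′ xs) + c * n)  ≡⟨ cong (λ l → g x + (sum l + c * n)) map-g′ ⟩
  g x + (sum (map g xs) + c * n)   ≡⟨ +-assoc (g x) _ _ ⟨
  g x + sum (map g xs) + c * n     ∎
  where
  open ≤-Reasoning
  g′ = updateAt g x (const c)
  map-g′ : map g′ xs ≡ map g xs
  map-g′ = map-cong-local (All.map (λ x≢y → updateAt-minimal _ x g (x≢y ∘ sym)) x∉)
  outside : ∀ y → y ∉ xs → g′ y ≤ c
  outside y y∉ with y Fin.≟ x
  ... | yes refl = ≤-reflexive (updateAt-updates x g)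
  ... | no  y≢x  = ≤-trans (≤-reflexive (updateAt-minimal y x g y≢x))
                     (h y λ { (here e) → y≢x e ; (there m) → y∉ m })

-- Lists without repetition and their rearrangements.

cast-injective : ∀ {m n} .(e : m ≡ n) {i j : Fin m} → cast e i ≡ cast e j → i ≡ j
cast-injective e {i} {j} h = Fin.toℕ-injective
  (≡.trans (sym (Fin.toℕ-cast e i)) (≡.trans (cong toℕ h) (Fin.toℕ-cast e j)))

module _ {A : Set} where

  Unique-resp-↭ : {xs ys : List A} → xs ↭ ys → Unique xs → Unique ys
  Unique-resp-↭ p = ↭ₛ.Unique-resp-↭ (setoid A) (↭⇒↭ₛ p)

  lookup-injective : {xs : List A} → Unique xs → ∀ i j → lookup xs i ≡ lookup xs j → i ≡ j
  lookup-injective (x∉ ∷ u) zero    zero    e = refl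
  lookup-injective (x∉ ∷ u) zero    (suc j) e = contradiction e (All.lookup x∉ (∈-lookup j))
  lookup-injective (x∉ ∷ u) (suc i) zero    e = contradiction (sym e) (All.lookup x∉ (∈-lookup i))
  lookup-injective (x∉ ∷ u) (suc i) (suc j) e = cong suc (lookup-injective u i j e)

  rotate-↭ : ∀ {a b c : A} {xs} → a ∷ b ∷ c ∷ xs ↭ b ∷ c ∷ a ∷ xs
  rotate-↭ {a} {b} {c} = trans (swap a b refl) (prep b (swap a c refl))

  next-↭ : ∀ (w : Fin 3 → A) {xs} i →
    w 0F ∷ w 1F ∷ w 2F ∷ xs ↭ w i ∷ w (next i) ∷ w (next (next i)) ∷ xs
  next-↭ w 0F = refl
  next-↭ w 1F = rotate-↭
  next-↭ w 2F = trans rotate-↭ rotate-↭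

  shift-↭ : ∀ {a b c x : A} {xs} → x ∷ a ∷ b ∷ c ∷ xs ↭ a ∷ b ∷ c ∷ x ∷ xs
  shift-↭ {a} {b} {c} {x} = trans (swap x a refl) (prep a rotate-↭)

  shift₃-↭ : ∀ {a b c x y z : A} {xs} →
    x ∷ y ∷ z ∷ a ∷ b ∷ c ∷ xs ↭ a ∷ b ∷ c ∷ x ∷ y ∷ z ∷ xs
  shift₃-↭ = trans (prep _ (prep _ shift-↭)) (trans (prep _ shift-↭) shift-↭)

-- Tilings as lists of covered vertices.

module _ {n : ℕ} where
  open DecMembership (Fin._≟_ {n}) public using (_∈?_)

-- The list index makes disjointness the single condition `Unique xs`, and exchanging vertices
-- between triangles becomes a permutation of the list.
data Tiled (M : Multigraph n) : ℕ → List (Fin n) → Set where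
  []  : Tiled M 0 []
  _∷_ : ∀ {k a b c xs} → FiveTriangle M a b c → Tiled M k xs → Tiled M (suc k) (a ∷ b ∷ c ∷ xs)

Tiling : Multigraph n → ℕ → Set
Tiling M k = ∃ λ xs → Unique xs × Tiled M k xs

module _ (M : Multigraph n) where

  length-tiled : ∀ {xs} → Tiled M k xs → length xs ≡ k * 3
  length-tiled []      = refl
  length-tiled (_ ∷ T) = cong (3 +_) (length-tiled T)

  five-rotate : ∀ {a b c} → FiveTriangle M a b c → FiveTriangle M b c a
  five-rotate {a} {b} {c} (ab , bc , ac , s)
    rewrite symmetric M b a | symmetric M c a =
    bc , ac , ab , subst (5 ≤_) (≡.trans (+-assoc (μ M a b) _ _) (+-comm (μ M a b) _)) s

  tiling⇒triangles : Tiling M k → DisjointFiveTriangles M k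
  tiling⇒triangles {k} (xs , u , T) = t , injective , five T
    where
    position : ∀ {k ys} → Tiled M k ys → Fin k × Fin 3 → Fin (length ys)
    -- Vertex `j` of triangle `i` sits at position 3i + j.
    position T (i , j) = cast (sym (length-tiled T)) (combine i j)
    t : Fin k × Fin 3 → Fin n
    t p = lookup xs (position T p)
    injective : ∀ {p q} → t p ≡ t q → p ≡ q
    injective {i , j} {i′ , j′} e
      with refl , refl ← Fin.combine-injective i j i′ j′ (cast-injective (sym (length-tiled T))
             (lookup-injective u (position T (i , j)) (position T (i′ , j′)) e)) = refl
    five : ∀ {k ys} (T : Tiled M k ys) i → let t = λ j → lookup ys (position T (i , j)) in
      FiveTriangle M (t 0F) (t 1F) (t 2F)
    five (f ∷ T) zero    = f
    five (f ∷ T) (suc i) = five T i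

  -- Averaging over the tiles. A heavy tile is brought to the front, where it can be split off and
  -- rebuilt.
  heavy-tile : ∀ (g : Fin n → ℕ) c {xs} → Tiled M k xs →
    (∃ λ k′ → ∃ λ (a : Fin 3 → Fin n) → ∃ λ ys → k ≡ suc k′ ×
      xs ↭ a 0F ∷ a 1F ∷ a 2F ∷ ys × FiveTriangle M (a 0F) (a 1F) (a 2F) ×
      Tiled M k′ ys × c < total (g ∘ a))
    ⊎ sum (map g xs) ≤ c * k
  heavy-tile g c [] = inj₂ z≤n
  heavy-tile {k = suc k} g c {x ∷ y ∷ z ∷ xs} (f ∷ T) with total (g ∘ a) ≤? c | heavy-tile g c T
    where a = x F.∷ y F.∷ z F.∷ F.[]
  ... | no  h | _ = inj₁ (_ , x F.∷ y F.∷ z F.∷ F.[] , xs , refl , refl , f , T , ≰⇒> h)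
  ... | yes h | inj₂ s = inj₂ (begin
      g x + (g y + (g z + sum (map g xs)))  ≡⟨ +-assoc (g x) (g y) _ ⟨
      g x + g y + (g z + sum (map g xs))    ≡⟨ +-assoc (g x + g y) (g z) _ ⟨
      g x + g y + g z + sum (map g xs)      ≤⟨ +-mono-≤ h s ⟩
      c + c * k                             ≡⟨ *-suc c k ⟨
      c * suc k                             ∎)
    where open ≤-Reasoning
  ... | yes h | inj₁ (k′ , a , ys , refl , p , fa , T′ , l) =
    inj₁ (suc k′ , a , x ∷ y ∷ z ∷ ys , refl ,
      trans (prep x (prep y (prep z p))) shift₃-↭ , fa , f ∷ T′ , l)

  -- Isolates the one triangle that may use an added edge at `x`; rotating it puts `x` first.
  tile-at : ∀ {x xs} → Tiled M k xs → x ∈ xs →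
    ∃ λ k′ → ∃ λ b → ∃ λ c → ∃ λ ys → k ≡ suc k′ ×
      xs ↭ x ∷ b ∷ c ∷ ys × FiveTriangle M x b c × Tiled M k′ ys
  tile-at (f ∷ T) (here refl)                 = _ , _ , _ , _ , refl , refl , f , T
  tile-at (f ∷ T) (there (here refl))         = _ , _ , _ , _ , refl , rotate-↭ , five-rotate f , T
  tile-at (f ∷ T) (there (there (here refl))) =
    _ , _ , _ , _ , refl , trans rotate-↭ rotate-↭ , five-rotate (five-rotate f) , T
  tile-at {xs = a ∷ b ∷ c ∷ _} (f ∷ T) (there (there (there m))) with tile-at T m
  ... | k′ , b′ , c′ , ys , refl , p , fx , T′ =
    suc k′ , b′ , c′ , a ∷ b ∷ c ∷ ys , refl ,
    trans (prep a (prep b (prep c p))) shift₃-↭ ,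
    fx , f ∷ T′

  opposite : (Fin 3 → Fin n) → Triple
  opposite w i = μ M (w (next i)) (w (next (next i)))

-- Exchange argument for a triangle with four edges.

module _ (M : Multigraph n) (standard : Standard M) (minDegree : MinDegreeAtLeast3n-3/2 M) where

  -- Interchanging the sums turns the weighted edge count into the weighted sum of the degrees of
  -- the `w i`. The factor 2 clears the half in the degree bound, and 24 = 8·3 stands on the right
  -- in place of a subtraction.
  weighted-degrees : ∀ ω → total ω ≡ 8 → (w : Fin 3 → Fin n) →
    24 * n ≤ 2 * ∑ (λ y → weight ω (λ i → μ M y (w i))) + 24
  weighted-degrees ω ω≡8 w = begin
    24 * n
      ≡⟨ *-assoc 8 3 n ⟩
    8 * (3 * n)
      ≤⟨ *-monoʳ-≤ 8 (m≤n+m∸n (3 * n) 3) ⟩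
    8 * (3 + d)
      ≡⟨ *-distribˡ-+ 8 3 d ⟩
    24 + 8 * d
      ≡⟨ cong (λ t → 24 + t * d) ω≡8 ⟨
    24 + total ω * d
      ≡⟨ cong (24 +_) (solve 4 (λ a b c d → (a :+ b :+ c) :* d := a :* d :+ b :* d :+ c :* d)
           refl (ω 0F) (ω 1F) (ω 2F) d) ⟩
    24 + weight ω (const d)
      ≤⟨ +-monoʳ-≤ 24 (+-mono-≤ (+-mono-≤ (h 0F) (h 1F)) (h 2F)) ⟩
    24 + weight ω (λ i → 2 * deg M (w i))
      ≡⟨ solve 6 (λ a b c x y z →
           con 24 :+ (a :* (con 2 :* x) :+ b :* (con 2 :* y) :+ c :* (con 2 :* z)) :=
           con 2 :* (a :* x :+ b :* y :+ c :* z) :+ con 24)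
           refl (ω 0F) (ω 1F) (ω 2F) _ _ _ ⟩
    2 * weight ω (λ i → deg M (w i)) + 24
      ≡⟨ cong (λ s → 2 * s + 24)
           (weight-cong ω λ i → ∑-cong λ y → symmetric M (w i) y) ⟩
    2 * weight ω (λ i → ∑ λ y → μ M y (w i)) + 24
      ≡⟨ cong (λ s → 2 * s + 24) (∑-weight ω (λ y i → μ M y (w i))) ⟨
    2 * ∑ (λ y → weight ω (λ i → μ M y (w i))) + 24
      ∎
    where
    open ≤-Reasoning
    open +-*-Solver
    d = 3 * n ∸ 3
    h : ∀ i → ω i * d ≤ ω i * (2 * deg M (w i))
    h i = *-monoʳ-≤ (ω i) (minDegree (w i))

  augment : ∀ (w : Fin 3 → Fin n) {zs} → total (opposite M w) ≡ 4 →
    Unique (w 0F ∷ w 1F ∷ w 2F ∷ zs) → Tiled M k zs → Tiling M (suc k)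
  augment {k} w {zs} e u T with encode (opposite M w) (λ i → standard _ _)
  ... | v , ev = conclude
    where
    v≡4 : total (val v) ≡ 4
    v≡4 = ≡.trans (total-cong ev) e

    ω : Triple
    ω = weights (val v)

    g : Fin n → ℕ
    g y = weight ω (λ i → μ M y (w i))

    inside≡ : ∀ i j → inside (val v) i j ≡ μ M (w i) (w j)
    inside≡ 0F 0F = sym (loopless M _)
    inside≡ 0F 1F = ev 2F
    inside≡ 0F 2F = ≡.trans (ev 1F) (symmetric M _ _)
    inside≡ 1F 0F = ≡.trans (ev 2F) (symmetric M _ _)
    inside≡ 1F 1F = sym (loopless M _)
    inside≡ 1F 2F = ev 0F
    inside≡ 2F 0F = ev 1F
    inside≡ 2F 1F = ≡.trans (ev 0F) (symmetric M _ _)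
    inside≡ 2F 2F = sym (loopless M _)

    inside≤20 : total (g ∘ w) ≤ 20
    inside≤20 = subst (_≤ 20) (total-cong λ i → weight-cong ω (inside≡ i))
      (weights-inside v v≡4)

    completes : ∀ {r r′ i} → (∀ j → r j ≡ r′ j) →
      Completes (val v) r i → Completes (opposite M w) r′ i
    completes er = five-cong (er _) (ev _) (er _)

    extend : ∀ y → y ∉ w 0F ∷ w 1F ∷ w 2F ∷ zs → 12 < g y → Tiling M (suc k)
    extend y y∉ h with encode (λ i → μ M y (w i)) (λ i → standard _ _)
    ... | r , er with completable v v≡4 r (subst (12 <_) (sym (weight-cong ω er)) h)
    ... | i , f
      -- The replaced vertex `w i` is moved to the front and split off, with `y` next in line.
      with Unique-resp-↭ (trans (prep y (next-↭ w i)) (swap y (w i) refl)) (¬Any⇒All¬ _ y∉ ∷ u)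
    ... | _ ∷ u′ = _ , u′ , completes er f ∷ T

    exchange : ∀ {k′} (a : Fin 3 → Fin n) {ys} → zs ↭ a 0F ∷ a 1F ∷ a 2F ∷ ys →
      FiveTriangle M (a 0F) (a 1F) (a 2F) → Tiled M k′ ys → 36 < total (g ∘ a) →
      Tiling M (suc (suc k′))
    exchange a p f T′ h
      with encode (opposite M a) (λ i → standard _ _)
         | encode (λ i → μ M (a 0F) (w i)) (λ i → standard _ _)
         | encode (λ i → μ M (a 1F) (w i)) (λ i → standard _ _)
         | encode (λ i → μ M (a 2F) (w i)) (λ i → standard _ _)
    ... | va , ea | r₀ , e₀ | r₁ , e₁ | r₂ , e₂ = result
      where
      er : ∀ j i → rows r₀ r₁ r₂ j i ≡ μ M (a j) (w i)
      er 0F = e₀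
      er 1F = e₁
      er 2F = e₂
      result : Tiling M _
      result with exchangeable v v≡4 va
            -- The edges 01, 12, 02 of a 5-triangle are opposite to vertices 2, 0, 1; `opposite`
            -- reads the last one as 20, hence the symmetry.
            (five-cong (sym (ea 2F)) (sym (ea 0F)) (≡.trans (symmetric M _ _) (sym (ea 1F))) f)
            r₀ r₁ r₂
            (subst (36 <_) (sym (total-cong λ j → weight-cong ω (er j))) h)
      ... | i , j , fw , fa =
        _ , Unique-resp-↭ σ u , completes (er j) fw ∷ five-cong (ea j) (er _ i) (er _ i) fa ∷ T′
        where
        -- In the new order `a j` precedes the two remaining vertices of `w`; the two remaining
        -- vertices of `a` follow, and then `w i`.
        σ = trans (prep _ (prep _ (prep _ (trans p (next-↭ a j)))))
           (trans (next-↭ w i)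
           (trans (↭-sym shift-↭) (prep _ (trans rotate-↭ (prep _ (prep _ rotate-↭))))))

    conclude : Tiling M (suc k)
    conclude with Fin.any? (λ y → ¬? (y ∈? w 0F ∷ w 1F ∷ w 2F ∷ zs) ×-dec (12 <? g y))
                | heavy-tile M g 36 T
    ... | yes (y , y∉ , h) | _ = extend y y∉ h
    ... | no _ | inj₁ (k′ , a , ys , refl , p , f , T′ , h) = exchange a p f T′ h
    ... | no ∄ | inj₂ h =
      contradiction (weighted-degrees ω (weights-total v v≡4) w) (<⇒≱ (begin-strict
        -- Here 25 + 7 = 32, and 24 < 32 is twice the gap between 12 and 16.
        2 * ∑ g + 24    <⟨ +-monoʳ-< (2 * ∑ g) (m≤m+n 25 7) ⟩
        2 * ∑ g + 32    ≡⟨ *-distribˡ-+ 2 (∑ g) 16 ⟨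
        2 * (∑ g + 16)  ≤⟨ *-monoʳ-≤ 2 upper ⟩
        2 * (12 * n)    ≡⟨ *-assoc 2 12 n ⟨
        24 * n          ∎))
      where
      open ≤-Reasoning
      open +-*-Solver
      upper : ∑ g + 16 ≤ 12 * n
      -- Here `k` counts the tiles other than the triangle `w`. The 3 + 3k covered vertices account
      -- for 36 + 36k on the left, which exceeds 20 + 36k by 16.
      upper = +-cancelʳ-≤ (20 + 36 * k) _ _ (begin
        ∑ g + 16 + (20 + 36 * k)
          ≡⟨ solve 2 (λ s k → s :+ con 16 :+ (con 20 :+ con 36 :* k) :=
                              s :+ con 12 :* (con 3 :+ k :* con 3)) refl (∑ g) k ⟩
        ∑ g + 12 * (3 + k * 3)
          ≡⟨ cong (λ l → ∑ g + 12 * (3 + l)) (length-tiled M T) ⟨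
        ∑ g + 12 * (3 + length zs)
          ≤⟨ ∑-bound g 12 u (λ y y∉ → ≮⇒≥ λ l → ∄ (y , y∉ , l)) ⟩
        g (w 0F) + (g (w 1F) + (g (w 2F) + sum (map g zs))) + 12 * n
          ≡⟨ solve 5 (λ a b c s m → a :+ (b :+ (c :+ s)) :+ m := m :+ (a :+ b :+ c :+ s))
               refl (g (w 0F)) (g (w 1F)) (g (w 2F)) _ (12 * n) ⟩
        12 * n + (total (g ∘ w) + sum (map g zs))
          ≤⟨ +-monoʳ-≤ (12 * n) (+-mono-≤ inside≤20 h) ⟩
        12 * n + (20 + 36 * k)
          ∎)

-- Adding one edge.

δ : Fin n → Fin n → ℕ
δ u x = if does (u Fin.≟ x) then 1 else 0

δ-refl : ∀ (x : Fin n) → δ x x ≡ 1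
δ-refl x = cong (if_then 1 else 0) (dec-true (x Fin.≟ x) refl)

δ-≢ : ∀ {u x : Fin n} → u ≢ x → δ u x ≡ 0
δ-≢ {u = u} {x} u≢x = cong (if_then 1 else 0) (dec-false (u Fin.≟ x) u≢x)

-- At most one of `b` and `c` is `y`, so a triangle on `x`, `b`, `c` gains at most one edge from a
-- new edge between `x` and `y`.
δ-disjoint : ∀ {b c : Fin n} → b ≢ c → ∀ y → δ b y + δ c y ≤ 1
δ-disjoint {b = b} {c} b≢c y with b Fin.≟ y | c Fin.≟ y
... | yes refl | yes refl = contradiction refl b≢c
... | yes _    | no _     = ≤-refl
... | no _     | yes _    = ≤-refl
... | no _     | no _     = z≤n

-- For distinct `x` and `y`, the indicator of {u,v} = {x,y}, written with Kronecker deltas so that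
-- symmetry follows from commutativity.
isPair : (x y u v : Fin n) → ℕ
isPair x y u v = δ u x * δ v y + δ u y * δ v x

module _ {x y : Fin n} (x≢y : x ≢ y) where

  isPair-sym : ∀ u v → isPair x y u v ≡ isPair x y v u
  isPair-sym u v = ≡.trans (+-comm (δ u x * δ v y) _)
    (cong₂ _+_ (*-comm (δ u y) _) (*-comm (δ u x) _))

  isPair-loop : ∀ u → isPair x y u u ≡ 0
  isPair-loop u with u Fin.≟ x | u Fin.≟ y
  ... | yes refl | yes refl = contradiction refl x≢y
  ... | yes _    | no _     = refl
  ... | no _     | yes _    = refl
  ... | no _     | no _     = refl

  isPair-≤ : (f : Fin n → Fin n → ℕ) → (∀ u v → f u v ≡ f v u) → f x y ≤ 1 →
    (∀ u v → f u v ≤ 2) → ∀ u v → f u v + isPair x y u v ≤ 2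
  isPair-≤ f f-sym fxy f≤2 u v with u Fin.≟ x | v Fin.≟ y | u Fin.≟ y | v Fin.≟ x
  ... | yes refl | _        | yes refl | _        = contradiction refl x≢y
  ... | _        | yes refl | _        | yes refl = contradiction refl x≢y
  ... | yes refl | yes refl | no _     | no _     = +-monoˡ-≤ 1 fxy
  ... | no _     | no _     | yes refl | yes refl = +-monoˡ-≤ 1 (subst (_≤ 1) (f-sym x y) fxy)
  ... | yes refl | no _     | no _     | _        = subst (_≤ 2) (sym (+-identityʳ _)) (f≤2 u v)
  ... | no _     | _        | yes refl | no _     = subst (_≤ 2) (sym (+-identityʳ _)) (f≤2 u v)
  ... | no _     | _        | no _     | _        = subst (_≤ 2) (sym (+-identityʳ _)) (f≤2 u v)

  isPair-self : isPair x y x y ≡ 1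
  isPair-self = cong₂ _+_ (cong₂ _*_ (δ-refl x) (δ-refl y)) (cong (_* δ y x) (δ-≢ x≢y))

  isPair-from : ∀ v → isPair x y x v ≡ δ v y
  isPair-from v = ≡.trans (cong₂ _+_ (cong (_* δ v y) (δ-refl x)) (cong (_* δ v x) (δ-≢ x≢y)))
    (≡.trans (+-identityʳ _) (+-identityʳ _))

  isPair-off : ∀ {u v} → u ≢ x → v ≢ x → isPair x y u v ≡ 0
  isPair-off {u} {v} u≢x v≢x = cong₂ _+_ (cong (_* δ v y) (δ-≢ u≢x))
    (≡.trans (cong (δ u y *_) (δ-≢ v≢x)) (*-zeroʳ (δ u y)))

addEdge : (M : Multigraph n) {x y : Fin n} → x ≢ y → Multigraph n
addEdge M {x} {y} x≢y = record
  { μ         = λ u v → μ M u v + isPair x y u v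
  ; symmetric = λ u v → cong₂ _+_ (symmetric M u v) (isPair-sym x≢y u v)
  ; loopless  = λ u → cong₂ _+_ (loopless M u) (isPair-loop x≢y u)
  }

tiled-avoiding : ∀ (M M′ : Multigraph n) {x} →
  (∀ {u v} → u ≢ x → v ≢ x → μ M′ u v ≡ μ M u v) →
  ∀ {xs} → Tiled M′ k xs → x ∉ xs → Tiled M k xs
tiled-avoiding M M′ e []      x∉ = []
tiled-avoiding M M′ e (f ∷ T) x∉ =
  five-cong (e a b) (e b c) (e a c) f ∷ tiled-avoiding M M′ e T (λ m → x∉ (there (there (there m))))
  where
  a = λ { refl → x∉ (here refl) }
  b = λ { refl → x∉ (there (here refl)) }
  c = λ { refl → x∉ (there (there (here refl))) }

-- Any three distinct vertices span at least 6 edges, so the list is simply cut into consecutive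
-- triples.
complete-tiled : (M : Multigraph n) → (∀ {x y} → x ≢ y → 2 ≤ μ M x y) →
  ∀ k {xs} → Unique xs → length xs ≡ k * 3 → Tiled M k xs
complete-tiled M h zero    {[]} _ _ = []
complete-tiled M h (suc k) {a ∷ b ∷ c ∷ xs} ((ab ∷ ac ∷ _) ∷ (bc ∷ _) ∷ _ ∷ u) e =
  (≤-trans (s≤s z≤n) (h ab) , ≤-trans (s≤s z≤n) (h bc) , ≤-trans (s≤s z≤n) (h ac) ,
    ≤-trans (n≤1+n 5) (+-mono-≤ (+-mono-≤ (h ab) (h bc)) (h ac)))
  ∷ complete-tiled M h k u (suc-injective (suc-injective (suc-injective e)))

-- Induction on the number of missing edges.

deficiency : Multigraph n → ℕ
deficiency M = ∑ λ x → ∑ λ y → 2 ∸ μ M x y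

-- The recursion is structural in the bound `d`. For a standard `M` the deficiency is twice the
-- number of missing edges plus 2n from the diagonal.
tiling : ∀ d (M : Multigraph n) → deficiency M < d → Standard M → MinDegreeAtLeast3n-3/2 M →
  k * 3 ≤ n → Tiling M k
tiling {n} {k} (suc d) M D<d standard minDegree k≤
  with Fin.any? (λ x → Fin.any? (λ y → ¬? (x Fin.≟ y) ×-dec (μ M x y ≤? 1)))
... | no ∄ = _ , unique , complete-tiled M
    (λ x≢y → ≰⇒> λ l → ∄ (_ , _ , x≢y , l)) k unique
    (≡.trans (length-take (k * 3) (allFin n))
      (m≤n⇒m⊓n≡m (subst (k * 3 ≤_) (sym (length-tabulate {n = n} (λ i → i))) k≤)))
  where
  unique : Unique (take (k * 3) (allFin n))
  unique = Unique.take⁺ (k * 3) (Unique.allFin⁺ n)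
... | yes (x , y , x≢y , xy≤1) = repair (tiling d M′ D′<d standard′ minDegree′ k≤)
  where
  M′ = addEdge M x≢y

  D′<d : deficiency M′ < d
  D′<d = <-≤-trans
    (∑-mono-< (λ u → ∑-mono-≤ (shrinks u)) x (∑-mono-< (shrinks x) y strict)) (s≤s⁻¹ D<d)
    where
    shrinks : ∀ u v → 2 ∸ μ M′ u v ≤ 2 ∸ μ M u v
    shrinks u v = ∸-monoʳ-≤ 2 (m≤m+n (μ M u v) _)
    strict : 2 ∸ μ M′ x y < 2 ∸ μ M x y
    -- Truncated subtraction drops strictly here because the raised multiplicity is still at most 2.
    strict rewrite isPair-self x≢y = ∸-monoʳ-< (m<m+n (μ M x y) (s≤s z≤n)) (+-monoˡ-≤ 1 xy≤1)

  standard′ : Standard M′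
  standard′ = isPair-≤ x≢y (μ M) (symmetric M) xy≤1 standard

  minDegree′ : MinDegreeAtLeast3n-3/2 M′
  minDegree′ u = ≤-trans (minDegree u) (*-monoʳ-≤ 2 (∑-mono-≤ λ v → m≤m+n (μ M u v) _))

  off-x : ∀ {u v} → u ≢ x → v ≢ x → μ M′ u v ≡ μ M u v
  off-x {u} {v} u≢x v≢x = ≡.trans (cong (μ M u v +_) (isPair-off x≢y u≢x v≢x)) (+-identityʳ _)

  repair : ∀ {k} → Tiling M′ k → Tiling M k
  repair (xs , u , T) with x ∈? xs
  ... | no x∉ = xs , u , tiled-avoiding M M′ off-x T x∉
  ... | yes x∈ with tile-at M′ T x∈
  ... | k′ , b , c , ys , refl , p , f , T′ with Unique-resp-↭ p u
  ... | u′@((x≢b ∷ x≢c ∷ x∉ys) ∷ (b≢c ∷ _) ∷ _) = retile (5 ≤? μ M x b + μ M b c + μ M x c)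
    where
    T″ : Tiled M k′ ys
    T″ = tiled-avoiding M M′ off-x T′ (All¬⇒¬Any x∉ys)

    -- Removing the added edge costs this triangle at most one edge, so failing to have five in `M`
    -- means having exactly four.
    four : 5 ≤ suc (μ M x b + μ M b c + μ M x c)
    four = begin
      5
        ≤⟨ proj₂ (proj₂ (proj₂ f)) ⟩
      μ M′ x b + μ M′ b c + μ M′ x c
        ≡⟨ cong₂ _+_
             (cong₂ _+_ (cong (μ M x b +_) (isPair-from x≢y b)) (off-x (x≢b ∘ sym) (x≢c ∘ sym)))
             (cong (μ M x c +_) (isPair-from x≢y c)) ⟩
      μ M x b + δ b y + μ M b c + (μ M x c + δ c y)
        ≡⟨ solve 5 (λ p q r s t → p :+ s :+ q :+ (r :+ t) := s :+ t :+ (p :+ q :+ r))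
             refl (μ M x b) (μ M b c) (μ M x c) (δ b y) (δ c y) ⟩
      δ b y + δ c y + (μ M x b + μ M b c + μ M x c)
        ≤⟨ +-monoˡ-≤ _ (δ-disjoint b≢c y) ⟩
      suc (μ M x b + μ M b c + μ M x c)
        ∎
      where
      open ≤-Reasoning
      open +-*-Solver

    retile : Dec (5 ≤ μ M x b + μ M b c + μ M x c) → Tiling M (suc k′)
    retile (yes h) = _ , u′ , five-of-sum (standard x b) (standard b c) (standard x c) h ∷ T″
    retile (no h)  = augment M standard minDegree (x F.∷ b F.∷ c F.∷ F.[]) w≡4 u′ T″
      where
      w≡4 : μ M b c + μ M c x + μ M x b ≡ 4
      w≡4 = begin
        μ M b c + μ M c x + μ M x b    ≡⟨ +-comm _ (μ M x b) ⟩
        μ M x b + (μ M b c + μ M c x)  ≡⟨ +-assoc (μ M x b) _ _ ⟨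
        μ M x b + μ M b c + μ M c x    ≡⟨ cong (μ M x b + μ M b c +_) (symmetric M c x) ⟩
        μ M x b + μ M b c + μ M x c    ≡⟨ ≤-antisym (s≤s⁻¹ (≰⇒> h)) (s≤s⁻¹ four) ⟩
        4                              ∎
        where open ≡-Reasoning

theorem13 : (n : ℕ) (M : Multigraph n) → Standard M →
    MinDegreeAtLeast3n-3/2 M → DisjointFiveTriangles M (n / 3)
theorem13 n M standard minDegree =
  tiling⇒triangles M (tiling (suc (deficiency M)) M ≤-refl standard minDegree (m/n*n≤m n 3))
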